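{- Let $\Sigma$ be a signature, $\mathbf{K}$ a quasivariety of $\Sigma$-structures and $X$ a set of variables. If $(Co_{\mathbf{K}},i)$ is a filter pair such that $i_{Fm(X)}:Co_{\mathbf{K}}(Fm(X))\to\mathcal{P}(Fm(X))$ is injective, then the associated logic $(\Sigma,\vdash^X)$ is algebraizable.
   Context: $\Sigma$-Str is the category of $\Sigma$-structures and homomorphisms; $Fm(X)$ is the absolutely free $\Sigma$-structure on $X$. $AL$ is the category of algebraic lattices with maps preserving arbitrary meets and directed joins. A filter pair over $\Sigma$ is a pair $(G,i)$ of a contravariant functor $G:\Sigma\text{ -Str}\to AL$ and maps $i_A:G(A)\to(\mathcal{P}(A),\subseteq)$, one for each $\Sigma$-structure $A$, preserving arbitrary infima (in particular $i_A(\top)=A$) and directed suprema, and such that $i_A\circ G(h)=h^{ -1}\circ i_B$ for every homomorphism $h:A\to B$. The associated logic $(\Sigma,\vdash^X)$: for $\Gamma\cup\{\varphi\}\subseteq Fm(X)$, $\Gamma\vdash^X\varphi$ iff for every $a\in G(Fm(X))$, $\Gamma\subseteq i_{Fm(X)}(a)$ implies $\varphi\in i_{Fm(X)}(a)$. For a quasivariety $\mathbf{K}$ (a class axiomatizable by quasi-identities), $Co_{\mathbf{K}}(A)$ is the lattice of congruences $\theta$ on $A$ with $A/\theta\in\mathbf{K}$, ordered by inclusion, and $Co_{\mathbf{K}}(f)=(f\times f)^{ -1}$ on homomorphisms; this is a contravariant functor to $AL$. A logic $l=(\Sigma,\vdash_l)$ is algebraizable (Blok–Pigozzi) if there are a class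 $\mathbf{K}'$ of $\Sigma$-structures, a set $\tau$ of equations $\delta(x)\approx\epsilon(x)$ in one variable and a finite set $\Delta(p,q)$ of formulas in two variables such that (1) $\Gamma\vdash_l\varphi$ iff $\{\delta(\gamma)\approx\epsilon(\gamma)\mid\gamma\in\Gamma,\,\delta\approx\epsilon\in\tau\}\models_{\mathbf{K}'}\delta(\varphi)\approx\epsilon(\varphi)$ for all $\delta\approx\epsilon\in\tau$; (2) for every set $\Gamma$ of equations and equation $\varphi\approx\psi$, $\Gamma\models_{\mathbf{K}'}\varphi\approx\psi$ iff $\bigcup\{\Delta(\xi,\eta)\mid\xi\approx\eta\in\Gamma\}\vdash_l\Delta(\varphi,\psi)$; (3) for every formula $\psi$, $\psi$ and $\bigcup\{\Delta(\delta(\psi),\epsilon(\psi))\mid\delta\approx\epsilon\in\tau\}$ are interderivable in $l$. Here $\Gamma\models_{\mathbf{K}'}\varphi\approx\psi$ means that for every $A\in\mathbf{K}'$ and homomorphism $h:Fm(X)\to A$ identifying both sides of every equation in $\Gamma$, $h(\varphi)=h(\psi)$.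
   Formalization: X is assumed to contain two distinct variables (the claim fails otherwise: one constant c, K all structures, X={x}, i(θ) the class of c) and to have decidable equality, which holds classically. -}

module Defs where

open import Axiom.ExcludedMiddle using (ExcludedMiddle)
open import Data.Fin.Base using (Fin; zero; suc)
open import Data.List.Base using (List) renaming (_∷_ to _∷ᴸ_)
open import Data.List.Membership.Propositional using () renaming (_∈_ to _∈ˡ_)
open import Data.List.Relation.Unary.All as All using (All; []; _∷_)
open import Data.Nat.Base using (ℕ)
open import Data.Product.Base using (∃; ∃-syntax; _×_; _,_; proj₁; proj₂)
open import Data.Vec.Base as Vec using (Vec; []; _∷_)
open import Data.Vec.Properties using (map-id; map-∘)
open import Data.Vec.Relation.Binary.Pointwise.Inductive as Pointwise
  using (Pointwise; []; _∷_)
open import Function.Base using (_∘_; id)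
open import Function.Bundles using (_⇔_; mk⇔; module Equivalence)
open import Level using (Level; _⊔_; Lift; lift; lower) renaming (suc to lsuc)
open import Relation.Binary.Bundles using (Setoid; Poset)
open import Relation.Binary.Core using (Rel; _⇒_; _Preserves_⟶_)
open import Relation.Binary.Definitions using (_Respects_)
open import Relation.Binary.Morphism.Bundles using (PosetHomomorphism; mkPosetHomo)
open import Relation.Binary.PropositionalEquality as ≡ using (_≡_)
open import Relation.Binary.Structures using (IsEquivalence)
open import Relation.Nullary.Decidable using (True; toWitness; fromWitness)
open import Relation.Unary using (Pred; _∈_; _⊆_; ｛_｝)

open PosetHomomorphism using (⟦_⟧)

private
  variable
    a c d i x ℓ ℓ₁ ℓ₂ ℓ₃ ℓ₄ : Level

------------------------------------------------------------------------
-- Algebraic lattices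

module _ (P : Poset c ℓ₁ ℓ₂) where
  open Poset P using (Carrier; _≤_)

  IsInfimum : {I : Set i} → (I → Carrier) → Carrier → Set _
  IsInfimum f m = (∀ j → m ≤ f j) × (∀ z → (∀ j → z ≤ f j) → z ≤ m)

  IsSupremum : {I : Set i} → (I → Carrier) → Carrier → Set _
  IsSupremum f m = (∀ j → f j ≤ m) × (∀ z → (∀ j → f j ≤ z) → m ≤ z)

  IsDirected : {I : Set i} → (I → Carrier) → Set _
  IsDirected {I = I} f = I × (∀ j k → ∃[ l ] (f j ≤ f l × f k ≤ f l))

  -- Subsets of the carrier are given as families indexed by types in the
  -- universe of the carrier, so that every subset cut out by a predicate in
  -- that universe is covered.

  IsCompact : Carrier → Set _
  IsCompact k = (I : Set c) (f : I → Carrier) → IsDirected f →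
    ∀ m → IsSupremum f m → k ≤ m → ∃[ j ] k ≤ f j

  record IsAlgebraicLattice : Set (lsuc c ⊔ ℓ₂) where
    field
      infimum  : (I : Set c) (f : I → Carrier) → ∃ (IsInfimum f)
      supremum : (I : Set c) (f : I → Carrier) → ∃ (IsSupremum f)
      compactlyGenerated : ∀ z →
        IsSupremum {I = ∃[ k ] (IsCompact k × k ≤ z)} proj₁ z

module _ (P : Poset c ℓ₁ ℓ₂) (Q : Poset d ℓ₃ ℓ₄) where
  private
    module P = Poset P
    module Q = Poset Q

  PreservesInfima : (P.Carrier → Q.Carrier) → Set _
  PreservesInfima g = (I : Set c) (f : I → P.Carrier) →
    ∀ m → IsInfimum P f m → IsInfimum Q (g ∘ f) (g m)

  PreservesDirectedSuprema : (P.Carrier → Q.Carrier) → Set _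
  PreservesDirectedSuprema g = (I : Set c) (f : I → P.Carrier) → IsDirected P f →
    ∀ m → IsSupremum P f m → IsSupremum Q (g ∘ f) (g m)

------------------------------------------------------------------------
-- Signatures, structures and formulas

-- Σ n is the set of n-ary operation symbols.

Signature : ∀ ℓ → Set (lsuc ℓ)
Signature ℓ = ℕ → Set ℓ

Interpretation : Signature ℓ → Set a → Set (ℓ ⊔ a)
Interpretation Σ C = ∀ {n} → Σ n → Vec C n → C

-- Structures are carried by setoids, so that the quotient by a congruence is
-- the same carrier with a coarser equality.  Throughout, the signature, the
-- structures and the sets of variables live in one arbitrary universe.

record Structure {ℓ} (Σ : Signature ℓ) : Set (lsuc ℓ) where
  field
    setoid : Setoid ℓ ℓ
  open Setoid setoid public
  field
    interp : Interpretation Σ Carrier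
    interp-cong : ∀ {n} (f : Σ n) {us vs : Vec Carrier n} →
      Pointwise _≈_ us vs → interp f us ≈ interp f vs

record Hom {ℓ} {Σ : Signature ℓ} (A B : Structure Σ) : Set ℓ where
  private
    module A = Structure A
    module B = Structure B
  field
    fun  : A.Carrier → B.Carrier
    cong : fun Preserves A._≈_ ⟶ B._≈_
    homo : ∀ {n} (f : Σ n) (us : Vec A.Carrier n) →
      fun (A.interp f us) B.≈ B.interp f (Vec.map fun us)

open Hom using (fun)

module _ {Σ : Signature ℓ} where

  idHom : (A : Structure Σ) → Hom A A
  idHom A = record
    { fun  = id
    ; cong = id
    ; homo = λ f us → reflexive (≡.cong (interp f) (≡.sym (map-id us)))
    }
    where open Structure A

  _∘ᴴ_ : {A B C : Structure Σ} → Hom B C → Hom A B → Hom A C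
  _∘ᴴ_ {C = C} g h = record
    { fun  = fun g ∘ fun h
    ; cong = Hom.cong g ∘ Hom.cong h
    ; homo = λ f us → C.trans (Hom.cong g (Hom.homo h f us))
        (C.trans (Hom.homo g f (Vec.map (fun h) us))
          (C.reflexive (≡.cong (C.interp f) (≡.sym (map-∘ (fun g) (fun h) us)))))
    }
    where module C = Structure C

data Fm {ℓ x} (Σ : Signature ℓ) (X : Set x) : Set (ℓ ⊔ x) where
  var : X → Fm Σ X
  op  : ∀ {n} → Σ n → Vec (Fm Σ X) n → Fm Σ X

module _ {Σ : Signature ℓ} {X : Set x} {C : Set a}
         (⟦op⟧ : Interpretation Σ C) (v : X → C) where

  eval  : Fm Σ X → C
  evals : ∀ {n} → Vec (Fm Σ X) n → Vec C n

  eval (var y)   = v y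
  eval (op f ts) = ⟦op⟧ f (evals ts)

  evals []       = []
  evals (t ∷ ts) = eval t ∷ evals ts

FmStr : (Σ : Signature ℓ) → Set ℓ → Structure Σ
FmStr Σ X = record
  { setoid      = ≡.setoid (Fm Σ X)
  ; interp      = op
  ; interp-cong = λ f → ≡.cong (op f) ∘ Pointwise.Pointwise-≡⇒≡
  }

module _ {Σ : Signature ℓ} {X : Set x} {Y : Set a} where

  _[_] : Fm Σ Y → (Y → Fm Σ X) → Fm Σ X
  φ [ σ ] = eval op σ φ

-- Formulas in one variable x and in two variables p , q are formulas over
-- Fin 1 and Fin 2; δ ⟨ φ ⟩ is δ(φ) and δ ⟪ φ , ψ ⟫ is δ(φ , ψ).

module _ {Σ : Signature ℓ} {X : Set x} where

  _⟨_⟩ : Fm Σ (Fin 1) → Fm Σ X → Fm Σ X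
  δ ⟨ φ ⟩ = δ [ (λ _ → φ) ]

  _⟪_,_⟫ : Fm Σ (Fin 2) → Fm Σ X → Fm Σ X → Fm Σ X
  δ ⟪ φ , ψ ⟫ = δ [ (λ { zero → φ ; (suc zero) → ψ }) ]

-- The pair (φ , ψ) stands for the equation φ ≈ ψ.

Equation : Signature ℓ → Set x → Set (ℓ ⊔ x)
Equation Σ X = Fm Σ X × Fm Σ X

------------------------------------------------------------------------
-- Quasivarieties

record QuasiIdentity {ℓ} (Σ : Signature ℓ) : Set ℓ where
  field
    premises   : List (Equation Σ ℕ)
    conclusion : Equation Σ ℕ

open QuasiIdentity

module _ {Σ : Signature ℓ} (A : Structure Σ) where
  open Structure A

  Holds : {X : Set x} → (X → Carrier) → Equation Σ X → Set ℓ
  Holds v (s , t) = eval interp v s ≈ eval interp v t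

  Satisfies : QuasiIdentity Σ → Set ℓ
  Satisfies q = ∀ v → All (Holds v) (premises q) → Holds v (conclusion q)

record Quasivariety {ℓ} (Σ : Signature ℓ) : Set (lsuc ℓ) where
  field
    Member      : Pred (Structure Σ) ℓ
    axioms      : Pred (QuasiIdentity Σ) ℓ
    axiomatized : ∀ A → A ∈ Member ⇔ (∀ {q} → q ∈ axioms → Satisfies A q)

------------------------------------------------------------------------
-- Contravariant functors from Σ-structures to algebraic lattices: a functor to
-- posets together with the property of landing in algebraic lattices and maps
-- preserving infima and directed suprema

record PosetFunctor {ℓ} (Σ : Signature ℓ) c ℓ₁ ℓ₂
       : Set (lsuc (ℓ ⊔ c ⊔ ℓ₁ ⊔ ℓ₂)) where
  field
    G₀ : Structure Σ → Poset c ℓ₁ ℓ₂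
    G₁ : ∀ {A B} → Hom A B → PosetHomomorphism (G₀ B) (G₀ A)
    -- Homomorphisms agreeing up to the equality of the codomain are identified.
    G₁-cong : ∀ {A B} (h k : Hom A B) →
      (∀ u → Structure._≈_ B (fun h u) (fun k u)) →
      ∀ b → Poset._≈_ (G₀ A) (⟦ G₁ h ⟧ b) (⟦ G₁ k ⟧ b)
    G₁-id : ∀ {A} b → Poset._≈_ (G₀ A) (⟦ G₁ (idHom A) ⟧ b) b
    G₁-∘  : ∀ {A B C} (g : Hom B C) (h : Hom A B) b →
      Poset._≈_ (G₀ A) (⟦ G₁ (g ∘ᴴ h) ⟧ b) (⟦ G₁ h ⟧ (⟦ G₁ g ⟧ b))

record LandsInAL {ℓ} {Σ : Signature ℓ} (G : PosetFunctor Σ c ℓ₁ ℓ₂)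
       : Set (lsuc (ℓ ⊔ c) ⊔ ℓ₁ ⊔ ℓ₂) where
  open PosetFunctor G
  field
    isAlgebraicLattice : ∀ A → IsAlgebraicLattice (G₀ A)
    preservesInfima    : ∀ {A B} (h : Hom A B) →
      PreservesInfima (G₀ B) (G₀ A) ⟦ G₁ h ⟧
    preservesDirectedSuprema : ∀ {A B} (h : Hom A B) →
      PreservesDirectedSuprema (G₀ B) (G₀ A) ⟦ G₁ h ⟧

------------------------------------------------------------------------
-- Filter pairs and their logics

module _ {Σ : Signature ℓ} (A : Structure Σ) where
  open Structure A

  -- A subset of a setoid is a predicate closed under its equality.

  record Subset : Set (lsuc ℓ) where
    field
      pred     : Pred Carrier ℓ
      respects : pred Respects _≈_

  open Subset

  𝒫 : Poset (lsuc ℓ) ℓ ℓ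
  𝒫 = record
    { Carrier = Subset
    ; _≈_     = λ S T → (pred S ⊆ pred T) × (pred T ⊆ pred S)
    ; _≤_     = λ S T → pred S ⊆ pred T
    ; isPartialOrder = record
      { isPreorder = record
        { isEquivalence = record
          { refl  = id , id
          ; sym   = λ (p , q) → q , p
          ; trans = λ (p , q) (r , s) → r ∘ p , q ∘ s
          }
        ; reflexive = proj₁
        ; trans     = λ p q → q ∘ p
        }
      ; antisym = _,_
      }
    }

open Subset

preimage : {Σ : Signature ℓ} {A B : Structure Σ} → Hom A B → Subset B → Subset A
preimage h S = record
  { pred     = pred S ∘ fun h
  ; respects = respects S ∘ Hom.cong h
  }

record IsFilterPair {ℓ} {Σ : Signature ℓ} (G : PosetFunctor Σ c ℓ₁ ℓ₂)
       (i : ∀ A → PosetHomomorphism (PosetFunctor.G₀ G A) (𝒫 A))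
       : Set (lsuc (ℓ ⊔ c) ⊔ ℓ₁ ⊔ ℓ₂) where
  open PosetFunctor G
  field
    landsInAL : LandsInAL G
    preservesInfima : ∀ A → PreservesInfima (G₀ A) (𝒫 A) ⟦ i A ⟧
    preservesDirectedSuprema : ∀ A → PreservesDirectedSuprema (G₀ A) (𝒫 A) ⟦ i A ⟧
    natural : ∀ {A B} (h : Hom A B) b →
      Poset._≈_ (𝒫 A) (⟦ i A ⟧ (⟦ G₁ h ⟧ b)) (preimage h (⟦ i B ⟧ b))

Entailment : (Σ : Signature ℓ) → Set ℓ → Set (lsuc (lsuc ℓ))
Entailment {ℓ = ℓ} Σ X = Pred (Fm Σ X) ℓ → Fm Σ X → Set (lsuc ℓ)

associatedLogic : {Σ : Signature ℓ} (G : PosetFunctor Σ (lsuc ℓ) ℓ₁ ℓ₂) →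
  (∀ A → PosetHomomorphism (PosetFunctor.G₀ G A) (𝒫 A)) →
  (X : Set ℓ) → Entailment Σ X
associatedLogic {Σ = Σ} G i X Γ φ = (b : Poset.Carrier (G₀ (FmStr Σ X))) →
  Γ ⊆ pred (⟦ i (FmStr Σ X) ⟧ b) → φ ∈ pred (⟦ i (FmStr Σ X) ⟧ b)
  where open PosetFunctor G

------------------------------------------------------------------------
-- Algebraizability

module _ {Σ : Signature ℓ} {X : Set ℓ} where

  _⊨[_]_ : Pred (Equation Σ X) ℓ → Pred (Structure Σ) ℓ → Equation Σ X → Set (lsuc ℓ)
  E ⊨[ K ] (φ , ψ) = ∀ A → A ∈ K → (h : Hom (FmStr Σ X) A) →
    let open Structure A in
    (∀ {ξ η} → (ξ , η) ∈ E → fun h ξ ≈ fun h η) → fun h φ ≈ fun h ψ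

  τ[_] : Pred (Equation Σ (Fin 1)) ℓ → Pred (Fm Σ X) ℓ → Pred (Equation Σ X) ℓ
  τ[ τ ] Γ e = ∃[ γ ] ∃[ δ ] ∃[ ε ]
    (γ ∈ Γ × (δ , ε) ∈ τ × e ≡ (δ ⟨ γ ⟩ , ε ⟨ γ ⟩))

  Δ[_] : List (Fm Σ (Fin 2)) → Pred (Equation Σ X) ℓ → Pred (Fm Σ X) ℓ
  Δ[ Δ ] E χ = ∃[ ξ ] ∃[ η ] ∃[ d ]
    ((ξ , η) ∈ E × d ∈ˡ Δ × χ ≡ d ⟪ ξ , η ⟫)

  record IsAlgebraizable (_⊢_ : Entailment Σ X) : Set (lsuc (lsuc ℓ)) where
    field
      K′ : Pred (Structure Σ) ℓ
      τ  : Pred (Equation Σ (Fin 1)) ℓ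
      Δ  : List (Fm Σ (Fin 2))
      ⊢⇔⊨ : ∀ Γ φ →
        Γ ⊢ φ ⇔ (∀ {δ ε} → (δ , ε) ∈ τ → τ[ τ ] Γ ⊨[ K′ ] (δ ⟨ φ ⟩ , ε ⟨ φ ⟩))
      ⊨⇔⊢ : ∀ E φ ψ →
        E ⊨[ K′ ] (φ , ψ) ⇔ (∀ {d} → d ∈ˡ Δ → Δ[ Δ ] E ⊢ (d ⟪ φ , ψ ⟫))
      ψ⊢Δτψ : ∀ ψ {χ} → χ ∈ Δ[ Δ ] (τ[ τ ] ｛ ψ ｝) → ｛ ψ ｝ ⊢ χ
      Δτψ⊢ψ : ∀ ψ → Δ[ Δ ] (τ[ τ ] ｛ ψ ｝) ⊢ ψ

------------------------------------------------------------------------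
-- Relative congruences

module _ {Σ : Signature ℓ} (A : Structure Σ) where
  open Structure A

  record IsCongruence (_∼_ : Rel Carrier ℓ) : Set ℓ where
    field
      isEquivalence : IsEquivalence _∼_
      ≈⇒∼     : _≈_ ⇒ _∼_
      op-cong : ∀ {n} (f : Σ n) {us vs : Vec Carrier n} →
        Pointwise _∼_ us vs → interp f us ∼ interp f vs

  _/_ : {_∼_ : Rel Carrier ℓ} → IsCongruence _∼_ → Structure Σ
  _/_ {_∼_ = _∼_} θ = record
    { setoid      = record { _≈_ = _∼_ ; isEquivalence = IsCongruence.isEquivalence θ }
    ; interp      = interp
    ; interp-cong = IsCongruence.op-cong θ
    }

module _ {Σ : Signature ℓ} (K : Quasivariety Σ) where
  open Quasivariety K

  record KCongruence (A : Structure Σ) : Set (lsuc ℓ) where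
    open Structure A using (Carrier)
    field
      rel          : Rel Carrier ℓ
      isCongruence : IsCongruence A rel
      quotient∈K   : (A / isCongruence) ∈ Member
    open IsCongruence isCongruence public
    open IsEquivalence isEquivalence public

  open KCongruence using (rel)

  CoPoset : Structure Σ → Poset (lsuc ℓ) ℓ ℓ
  CoPoset A = record
    { Carrier = KCongruence A
    ; _≈_     = λ θ ζ → (rel θ ⇒ rel ζ) × (rel ζ ⇒ rel θ)
    ; _≤_     = λ θ ζ → rel θ ⇒ rel ζ
    ; isPartialOrder = record
      { isPreorder = record
        { isEquivalence = record
          { refl  = id , id
          ; sym   = λ (p , q) → q , p
          ; trans = λ (p , q) (r , s) → r ∘ p , q ∘ s
          }
        ; reflexive = proj₁
        ; trans     = λ p q → q ∘ p
        }
      ; antisym = _,_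
      }
    }

  module _ {A B : Structure Σ} (h : Hom A B) where
    private
      module A = Structure A
      module B = Structure B

    map-cong : {_∼_ : Rel B.Carrier ℓ} {n : ℕ} {us vs : Vec A.Carrier n} →
      Pointwise (λ u v → fun h u ∼ fun h v) us vs →
      Pointwise _∼_ (Vec.map (fun h) us) (Vec.map (fun h) vs)
    map-cong []       = []
    map-cong (p ∷ ps) = p ∷ map-cong ps

    module _ {X : Set x} (v : X → A.Carrier) where
      fun-eval : (t : Fm Σ X) →
        fun h (eval A.interp v t) B.≈ eval B.interp (fun h ∘ v) t
      fun-evals : ∀ {n} (ts : Vec (Fm Σ X) n) →
        Pointwise B._≈_ (Vec.map (fun h) (evals A.interp v ts))
                        (evals B.interp (fun h ∘ v) ts)
      fun-eval (var y)   = B.refl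
      fun-eval (op f ts) =
        B.trans (Hom.homo h f _) (B.interp-cong f (fun-evals ts))
      fun-evals []       = []
      fun-evals (t ∷ ts) = fun-eval t ∷ fun-evals ts

    pullback : KCongruence B → KCongruence A
    pullback θ = record
      { rel          = λ u v → rel θ (fun h u) (fun h v)
      ; isCongruence = isCong
      ; quotient∈K   = Equivalence.from (axiomatized (A / isCong)) λ {q} q∈ v ps →
          from∼ v (conclusion q) (Equivalence.to (axiomatized _) quotient∈K q∈ (fun h ∘ v)
            (All.map (λ {e} → to∼ v e) ps))
      }
      where
      open KCongruence θ using
        (quotient∈K; ≈⇒∼; op-cong; refl; sym; trans)
      isCong : IsCongruence A (λ u v → rel θ (fun h u) (fun h v))
      isCong = record
        { isEquivalence = record { refl = refl ; sym = sym ; trans = trans }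
        ; ≈⇒∼     = ≈⇒∼ ∘ Hom.cong h
        ; op-cong = λ f ps → trans (≈⇒∼ (Hom.homo h f _))
            (trans (op-cong f (map-cong ps)) (≈⇒∼ (B.sym (Hom.homo h f _))))
        }
      module _ (v : ℕ → A.Carrier) (e : Equation Σ ℕ) where
        private
          s = proj₁ e
          t = proj₂ e
        to∼ : rel θ (fun h (eval A.interp v s)) (fun h (eval A.interp v t)) →
              rel θ (eval B.interp (fun h ∘ v) s) (eval B.interp (fun h ∘ v) t)
        to∼ p = trans (≈⇒∼ (B.sym (fun-eval v s))) (trans p (≈⇒∼ (fun-eval v t)))
        from∼ : rel θ (eval B.interp (fun h ∘ v) s) (eval B.interp (fun h ∘ v) t) →
                rel θ (fun h (eval A.interp v s)) (fun h (eval A.interp v t))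
        from∼ p = trans (≈⇒∼ (fun-eval v s)) (trans p (≈⇒∼ (B.sym (fun-eval v t))))

  Co : PosetFunctor Σ (lsuc ℓ) ℓ ℓ
  Co = record
    { G₀      = CoPoset
    ; G₁      = λ {A} {B} h → mkPosetHomo (CoPoset B) (CoPoset A) (pullback h) (λ p → p)
    ; G₁-cong = λ {A} {B} h k h≈k θ →
        let open KCongruence θ
            to   = λ u → ≈⇒∼ (h≈k u)
        in (λ p → trans (sym (to _)) (trans p (to _)))
         , (λ p → trans (to _) (trans p (sym (to _))))
    ; G₁-id   = λ _ → id , id
    ; G₁-∘    = λ _ _ _ → id , id
    }

  ----------------------------------------------------------------------
  -- Classically, Co always lands in algebraic lattices, so the corresponding
  -- field of IsFilterPair restricts nothing when the functor is Co.  Excluded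
  -- middle serves only to bring the meet or directed union of a family indexed
  -- in a larger universe back into the universe of A.

  module _ (em : ExcludedMiddle (lsuc ℓ)) where
    private
      Resize : Set (lsuc ℓ) → Set ℓ
      Resize P = Lift ℓ (True (em {P}))

      resize : {P : Set (lsuc ℓ)} → P → Resize P
      resize p = lift (fromWitness p)

      unresize : {P : Set (lsuc ℓ)} → Resize P → P
      unresize r = toWitness (lower r)

    module _ (A : Structure Σ) where
      private
        module A = Structure A
        module C θ = KCongruence {A = A} θ

      module _ (I : Set (lsuc ℓ)) (f : I → KCongruence A) where

        private
          ⋂-rel : Rel A.Carrier ℓ
          ⋂-rel u v = Resize (∀ j → rel (f j) u v)

          ⋂-cong : IsCongruence A ⋂-rel
          ⋂-cong = record
            { isEquivalence = record
              { refl  = resize λ j → C.refl (f j)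
              ; sym   = λ p → resize λ j → C.sym (f j) (unresize p j)
              ; trans = λ p q → resize λ j →
                  C.trans (f j) (unresize p j) (unresize q j)
              }
            ; ≈⇒∼     = λ p → resize λ j → C.≈⇒∼ (f j) p
            ; op-cong = λ g ps → resize λ j →
                C.op-cong (f j) g (Pointwise.map (λ p → unresize p j) ps)
            }

        ⋂ : KCongruence A
        ⋂ = record
          { rel          = ⋂-rel
          ; isCongruence = ⋂-cong
          ; quotient∈K   = Equivalence.from (axiomatized _) λ q∈ v ps →
              resize λ j → Equivalence.to (axiomatized _) (C.quotient∈K (f j)) q∈ v
                (All.map (λ p → unresize p j) ps)
          }

        ⋂-isInfimum : IsInfimum (CoPoset A) f ⋂
        ⋂-isInfimum = (λ j p → unresize p j) , (λ z z≤f p → resize λ j → z≤f j p)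

      ⋁-isSupremum : (I : Set (lsuc ℓ)) (f : I → KCongruence A) →
        ∃ (IsSupremum (CoPoset A) f)
      ⋁-isSupremum I f =
        ⋂ _ (proj₁ {A = KCongruence A} {B = λ u → ∀ j → rel (f j) ⇒ rel u})
        , (λ j p → resize λ u → proj₂ u j p)
        , (λ z f≤z p → unresize p (z , f≤z))

      module _ {I : Set (lsuc ℓ)} (f : I → KCongruence A)
               (dir : IsDirected (CoPoset A) f) where
        private
          ⋃-rel : Rel A.Carrier ℓ
          ⋃-rel u v = Resize (∃[ j ] rel (f j) u v)

          collect : ∀ {n} {us vs : Vec A.Carrier n} → Pointwise ⋃-rel us vs →
            ∃[ j ] Pointwise (rel (f j)) us vs
          collect []       = proj₁ dir , []
          collect (p ∷ ps) with unresize p | collect ps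
          ... | j , q | k , qs with proj₂ dir j k
          ... | l , j≤l , k≤l = l , j≤l q ∷ Pointwise.map k≤l qs

          collectAll : (v : ℕ → A.Carrier) (es : List (Equation Σ ℕ)) →
            All (λ e → ⋃-rel (eval A.interp v (proj₁ e)) (eval A.interp v (proj₂ e))) es →
            ∃[ j ] All (λ e → rel (f j) (eval A.interp v (proj₁ e)) (eval A.interp v (proj₂ e))) es
          collectAll v _ []       = proj₁ dir , []
          collectAll v (_ ∷ᴸ es) (p ∷ ps) with unresize p | collectAll v es ps
          ... | j , q | k , qs with proj₂ dir j k
          ... | l , j≤l , k≤l = l , j≤l q ∷ All.map k≤l qs

          ⋃-cong : IsCongruence A ⋃-rel
          ⋃-cong = record
            { isEquivalence = record
              { refl  = resize (proj₁ dir , C.refl (f (proj₁ dir)))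
              ; sym   = λ p → let (j , q) = unresize p in resize (j , C.sym (f j) q)
              ; trans = λ p q →
                  let (j , p′) = unresize p
                      (k , q′) = unresize q
                      (l , j≤l , k≤l) = proj₂ dir j k
                  in resize (l , C.trans (f l) (j≤l p′) (k≤l q′))
              }
            ; ≈⇒∼     = λ p → resize (proj₁ dir , C.≈⇒∼ (f (proj₁ dir)) p)
            ; op-cong = λ g ps →
                let (j , qs) = collect ps in resize (j , C.op-cong (f j) g qs)
            }

        ⋃ : KCongruence A
        ⋃ = record
          { rel          = ⋃-rel
          ; isCongruence = ⋃-cong
          ; quotient∈K   = Equivalence.from (axiomatized _) λ {q} q∈ v ps →
              let (j , qs) = collectAll v (premises q) ps
              in resize (j , Equivalence.to (axiomatized _) (C.quotient∈K (f j)) q∈ v qs)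
          }

        ⋁⇒∃ : ∀ {m} → IsSupremum (CoPoset A) f m →
          ∀ {u v} → rel m u v → ∃[ j ] rel (f j) u v
        ⋁⇒∃ (_ , least) p = unresize (least ⋃ (λ j q → resize (j , q)) p)

      private
        principal : A.Carrier → A.Carrier → KCongruence A
        principal u v = ⋂ (∃[ θ ] Lift (lsuc ℓ) (rel θ u v)) proj₁

        principal-compact : ∀ u v → IsCompact (CoPoset A) (principal u v)
        principal-compact u v I f dir m sup ≤m
          with ⋁⇒∃ f dir {m} sup (≤m (resize λ (_ , p) → lower p))
        ... | j , p = j , λ q → unresize q (f j , lift p)

      CoPoset-isAlgebraicLattice : IsAlgebraicLattice (CoPoset A)
      CoPoset-isAlgebraicLattice = record
        { infimum    = λ I f → ⋂ I f , ⋂-isInfimum I f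
        ; supremum   = ⋁-isSupremum
        ; compactlyGenerated = λ z →
            (λ (_ , _ , k≤z) p → k≤z p)
          , (λ y compact≤y {u} {v} p → compact≤y
              ( principal u v , principal-compact u v
              , λ q → unresize q (z , lift p))
              (resize λ (_ , r) → lower r))
        }

    Co-landsInAL : LandsInAL Co
    Co-landsInAL = record
      { isAlgebraicLattice = CoPoset-isAlgebraicLattice
      ; preservesInfima = λ {A} {B} h I f m (m≤f , greatest) →
            (λ j p → m≤f j p)
          , (λ z z≤f p → greatest (⋂ B I f) (λ j q → unresize q j)
              (resize λ j → z≤f j p))
      ; preservesDirectedSuprema = λ {A} {B} h I f dir m sup →
            (λ j p → proj₁ sup j p)
          , (λ z f≤z p → let (j , q) = ⋁⇒∃ B f dir {m} sup p in f≤z j q)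
      }

{-# OPTIONS --safe #-}

-- Let F = Fm(X) and let θₚ be the least K-congruence θ on F with p ∈ i(θ); it
-- exists because i preserves infima.  Naturality of i along the substitutions
-- sending every variable to φ shows that φ ∈ i(θ) iff τ(φ) ⊆ θ, where
-- τ = {δ ≈ ε ∣ (δ(p), ε(p)) ∈ θₚ}.
--
-- For Δ, let κ be the K-congruence generated by (p , q) and let T = i(κ).  The
-- K-congruence generated by τ(T) lies below κ and has the same image under i,
-- so by injectivity it equals κ.  It is the directed union of the
-- K-congruences generated by τ(L), for L a finite subset of T, so (p , q)
-- already belongs to one of these; Δ is such an L, rewritten in the two
-- variables p and q.  Naturality along the substitutions p ↦ φ, q ↦ ψ then
-- gives Δ(φ,ψ) ⊆ i(θ) iff (φ,ψ) ∈ θ.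
--
-- Since ⊨ is membership in all K-congruences containing the premises, these two
-- equivalences give all the clauses of algebraizability.

module Submission where

open import Defs
open import Data.Fin.Base using (Fin; zero; suc)
open import Data.List.Base as List using (List; _++_)
open import Data.List.Membership.Propositional using () renaming (_∈_ to _∈ˡ_)
open import Data.List.Membership.Propositional.Properties using (∈-map⁺; ∈-map⁻)
open import Data.List.Relation.Binary.Subset.Propositional.Properties
  using (xs⊆xs++ys; xs⊆ys++xs)
open import Data.List.Relation.Unary.All as All using (All; []; _∷_)
open import Data.List.Relation.Unary.All.Properties using (++⁺)
open import Data.List.Relation.Unary.Any using (here)
open import Data.Nat.Base using (ℕ)
open import Data.Product.Base using (∃; ∃-syntax; _×_; _,_; proj₁; proj₂)
open import Data.Vec.Base as Vec using (Vec; []; _∷_)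
open import Data.Vec.Properties using (map-id)
open import Data.Vec.Relation.Binary.Pointwise.Inductive as Pointwise
  using (Pointwise; []; _∷_)
open import Function.Base using (_∘_; id; case_of_)
open import Function.Bundles using (_⇔_; mk⇔; module Equivalence)
open import Function.Definitions using (Injective)
open import Level using (Level)
open import Relation.Binary.Bundles using (Poset)
open import Relation.Binary.Core using (_⇒_)
open import Relation.Binary.Definitions using (DecidableEquality)
open import Relation.Binary.Morphism.Bundles using (PosetHomomorphism)
open import Relation.Binary.PropositionalEquality as ≡ using (_≡_; _≢_; refl)
open import Relation.Nullary.Decidable using (yes; no)
open import Relation.Nullary.Negation using (contradiction)
open import Relation.Unary using (Pred; _∈_; _⊆_; ｛_｝)

private
  variable
    x y z ℓ : Level

open QuasiIdentity

-- Substitutions and evaluation homomorphisms.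

module _ {Σ : Signature ℓ} {X : Set x} {Y : Set y} {Z : Set z} where

  []-∘ : (σ : Y → Fm Σ Z) (ρ : X → Fm Σ Y) (t : Fm Σ X) →
    t [ ρ ] [ σ ] ≡ t [ (λ w → ρ w [ σ ]) ]
  evals-∘ : (σ : Y → Fm Σ Z) (ρ : X → Fm Σ Y) →
    ∀ {n} (ts : Vec (Fm Σ X) n) →
    evals op σ (evals op ρ ts) ≡ evals op (λ w → ρ w [ σ ]) ts
  []-∘ σ ρ (var w)   = refl
  []-∘ σ ρ (op f ts) = ≡.cong (op f) (evals-∘ σ ρ ts)
  evals-∘ σ ρ []       = refl
  evals-∘ σ ρ (t ∷ ts) = ≡.cong₂ _∷_ ([]-∘ σ ρ t) (evals-∘ σ ρ ts)

module _ {Σ : Signature ℓ} (A : Structure Σ) {X : Set ℓ} where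
  open Structure A using (Carrier; interp; reflexive)

  private
    evals≡map : (v : X → Carrier) → ∀ {n} (ts : Vec (Fm Σ X) n) →
      evals interp v ts ≡ Vec.map (eval interp v) ts
    evals≡map v []       = refl
    evals≡map v (t ∷ ts) = ≡.cong (_ ∷_) (evals≡map v ts)

  evalHom : (X → Carrier) → Hom (FmStr Σ X) A
  evalHom v = record
    { fun  = eval interp v
    ; cong = λ { refl → Structure.refl A }
    ; homo = λ f ts → reflexive (≡.cong (interp f) (evals≡map v ts))
    }

-- Relative congruences and semantic consequence.

module _ {Σ : Signature ℓ} (K : Quasivariety Σ) where
  open Quasivariety K
  open KCongruence using (rel)

  module _ (A : Structure Σ) where
    open Structure A using (Carrier; interp; _≈_)

    quotientHom : (θ : KCongruence K A) → Hom A (A / KCongruence.isCongruence θ)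
    quotientHom θ = record
      { fun  = id
      ; cong = θ.≈⇒∼
      ; homo = λ f us → θ.≈⇒∼
          (Structure.reflexive A (≡.cong (interp f) (≡.sym (map-id us))))
      }
      where module θ = KCongruence θ

    diagonal : A ∈ Member → KCongruence K A
    diagonal A∈K = record
      { rel          = _≈_
      ; isCongruence = record
        { isEquivalence = Structure.isEquivalence A
        ; ≈⇒∼     = id
        ; op-cong = Structure.interp-cong A
        }
      ; quotient∈K   = Equivalence.from (axiomatized _)
          (Equivalence.to (axiomatized A) A∈K)
      }

    -- Inductive, because the intersection of all K-congruences containing `E` quantifies over a
    -- larger universe; `axiom` is what puts the quotient in `K`.
    data Gen (E : Pred (Carrier × Carrier) ℓ) : Carrier → Carrier → Set ℓ where
      base    : ∀ {u v} → (u , v) ∈ E → Gen E u v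
      equal   : ∀ {u v} → u ≈ v → Gen E u v
      sym     : ∀ {u v} → Gen E u v → Gen E v u
      trans   : ∀ {u v w} → Gen E u v → Gen E v w → Gen E u w
      op-cong : ∀ {n} (f : Σ n) {us vs : Vec Carrier n} →
        Pointwise (Gen E) us vs → Gen E (interp f us) (interp f vs)
      axiom   : ∀ {q} → q ∈ axioms → ∀ v →
        All (λ e → Gen E (eval interp v (proj₁ e)) (eval interp v (proj₂ e)))
            (premises q) →
        Gen E (eval interp v (proj₁ (conclusion q)))
              (eval interp v (proj₂ (conclusion q)))

    generated : Pred (Carrier × Carrier) ℓ → KCongruence K A
    generated E = record
      { rel          = Gen E
      ; isCongruence = record
        { isEquivalence = record
          { refl = equal (Structure.refl A) ; sym = sym ; trans = trans }
        ; ≈⇒∼     = equal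
        ; op-cong = op-cong
        }
      ; quotient∈K   = Equivalence.from (axiomatized _) axiom
      }

    module _ {E : Pred (Carrier × Carrier) ℓ} (θ : KCongruence K A)
             (E⊆θ : ∀ {u v} → (u , v) ∈ E → rel θ u v) where
      private module θ = KCongruence θ

      generated-least : Gen E ⇒ rel θ
      private
        leastᵛ : ∀ {n} {us vs : Vec Carrier n} →
          Pointwise (Gen E) us vs → Pointwise (rel θ) us vs
        leastᴸ : ∀ v {es} →
          All (λ e → Gen E (eval interp v (proj₁ e)) (eval interp v (proj₂ e))) es →
          All (λ e → rel θ (eval interp v (proj₁ e)) (eval interp v (proj₂ e))) es
      generated-least (base e)       = E⊆θ e
      generated-least (equal p)      = θ.≈⇒∼ p
      generated-least (sym p)        = θ.sym (generated-least p)
      generated-least (trans p q)    = θ.trans (generated-least p) (generated-least q)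
      generated-least (op-cong f ps) = θ.op-cong f (leastᵛ ps)
      generated-least (axiom q∈ v ps) =
        Equivalence.to (axiomatized _) θ.quotient∈K q∈ v (leastᴸ v ps)
      leastᵛ []       = []
      leastᵛ (p ∷ ps) = generated-least p ∷ leastᵛ ps
      leastᴸ v []       = []
      leastᴸ v (p ∷ ps) = generated-least p ∷ leastᴸ v ps

    module _ {I : Set ℓ} (f : I → KCongruence K A)
             (directed : IsDirected (CoPoset K A) f) where
      private
        module C θ = KCongruence {K = K} {A = A} θ

        j₀ : I
        j₀ = proj₁ directed

        collect : ∀ {n} {us vs : Vec Carrier n} →
          Pointwise (λ u v → ∃[ j ] rel (f j) u v) us vs →
          ∃[ j ] Pointwise (rel (f j)) us vs
        collect [] = j₀ , []
        collect ((j , p) ∷ ps) =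
          let (k , qs)        = collect ps
              (l , j≤l , k≤l) = proj₂ directed j k
          in l , j≤l p ∷ Pointwise.map k≤l qs

        collectAll : ∀ v {es : List (Equation Σ ℕ)} →
          All (λ e → ∃[ j ] rel (f j) (eval interp v (proj₁ e))
                                      (eval interp v (proj₂ e))) es →
          ∃[ j ] All (λ e → rel (f j) (eval interp v (proj₁ e))
                                      (eval interp v (proj₂ e))) es
        collectAll v [] = j₀ , []
        collectAll v ((j , p) ∷ ps) =
          let (k , qs)        = collectAll v ps
              (l , j≤l , k≤l) = proj₂ directed j k
          in l , j≤l p ∷ All.map k≤l qs

      -- Operations have finitely many arguments and quasi-identities finitely many premises, so
      -- directedness gathers them all into a single `f j`. A small `I` keeps the union at level
      -- `ℓ`.
      directedUnion : KCongruence K A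
      directedUnion = record
        { rel          = λ u v → ∃[ j ] rel (f j) u v
        ; isCongruence = record
          { isEquivalence = record
            { refl  = j₀ , C.refl (f j₀)
            ; sym   = λ (j , p) → j , C.sym (f j) p
            ; trans = λ (j , p) (k , q) →
                let (l , j≤l , k≤l) = proj₂ directed j k
                in l , C.trans (f l) (j≤l p) (k≤l q)
            }
          ; ≈⇒∼     = λ p → j₀ , C.≈⇒∼ (f j₀) p
          ; op-cong = λ g ps → let (j , qs) = collect ps in j , C.op-cong (f j) g qs
          }
        ; quotient∈K   = Equivalence.from (axiomatized _) λ q∈ v ps →
            let (j , qs) = collectAll v ps
            in j , Equivalence.to (axiomatized _) (C.quotient∈K (f j)) q∈ v qs
        }

  -- A K-congruence gives the quotient map into a member of `K`; conversely the kernel of a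
  -- homomorphism into a member, the pullback of the diagonal, is a K-congruence.
  ⊨⇔∈KCongruences : {X : Set ℓ} (E : Pred (Equation Σ X) ℓ) (φ ψ : Fm Σ X) →
    E ⊨[ Member ] (φ , ψ) ⇔
    (∀ (θ : KCongruence K (FmStr Σ X)) →
      (∀ {ξ η} → (ξ , η) ∈ E → rel θ ξ η) → rel θ φ ψ)
  ⊨⇔∈KCongruences {X} E φ ψ = mk⇔
    (λ E⊨ θ → E⊨ _ (KCongruence.quotient∈K θ) (quotientHom (FmStr Σ X) θ))
    (λ all A A∈K h → all (pullback K h (diagonal A A∈K)))

-- Filters, naturality and least congruences.

module _ {Σ : Signature ℓ} (K : Quasivariety Σ) {X : Set ℓ}
         (i : ∀ A → PosetHomomorphism (CoPoset K A) (𝒫 A))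
         (isFilterPair : IsFilterPair (Co K) i) where
  open IsFilterPair isFilterPair
  open KCongruence using (rel)
  open PosetHomomorphism using (mono)

  private
    F = FmStr Σ X
    Con = KCongruence K F

  filter : Con → Pred (Fm Σ X) ℓ
  filter θ = Subset.pred (PosetHomomorphism.⟦_⟧ (i F) θ)

  filter-mono : {θ ζ : Con} → rel θ ⇒ rel ζ → filter θ ⊆ filter ζ
  filter-mono {θ} {ζ} = mono (i F) {θ} {ζ}

  inverseImage : (X → Fm Σ X) → Con → Con
  inverseImage σ = pullback K (evalHom F σ)

  ∈filter-inverseImage : ∀ σ θ φ → φ ∈ filter (inverseImage σ θ) ⇔ φ [ σ ] ∈ filter θ
  ∈filter-inverseImage σ θ φ =
    let (to , from) = natural (evalHom F σ) θ in mk⇔ to from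

  module _ (φ : Fm Σ X) where
    private
      Containing : Set _
      Containing = ∃[ θ ] φ ∈ filter θ

      leastContaining : ∃ (IsInfimum (CoPoset K F) {I = Containing} proj₁)
      leastContaining = IsAlgebraicLattice.infimum
        (LandsInAL.isAlgebraicLattice landsInAL F) Containing proj₁

    least : Con
    least = proj₁ leastContaining

    least-≤ : ∀ θ → φ ∈ filter θ → rel least ⇒ rel θ
    least-≤ θ φ∈ = proj₁ (proj₂ leastContaining) (θ , φ∈)

    ∈filter-least : φ ∈ filter least
    ∈filter-least =
      proj₂ (preservesInfima F Containing proj₁ least (proj₂ leastContaining))
        -- The singleton of `φ` is a lower bound of the filters in the family, hence lies below the
        -- filter of their infimum.
        (record { pred = ｛ φ ｝ ; respects = λ { refl → id } })
        (λ { (_ , φ∈) refl → φ∈ }) refl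

  -- Defining equations.

  module _ (p : X) where

    defining : Pred (Equation Σ (Fin 1)) ℓ
    defining (δ , ε) = rel (least (var p)) (δ ⟨ var p ⟩) (ε ⟨ var p ⟩)

    private
      const : Fm Σ X → X → Fm Σ X
      const φ _ = φ

      x₀ : X → Fm Σ (Fin 1)
      x₀ _ = var zero

      ⟨⟩-const : ∀ φ (δ : Fm Σ (Fin 1)) → δ ⟨ var p ⟩ [ const φ ] ≡ δ ⟨ φ ⟩
      ⟨⟩-const φ = []-∘ (const φ) (λ _ → var p)

      x₀-⟨⟩ : ∀ φ s → s [ x₀ ] ⟨ φ ⟩ ≡ s [ const φ ]
      x₀-⟨⟩ φ = []-∘ (λ _ → φ) x₀

      -- Since `φ` is the image of `p` under `const φ`, naturality moves the question to whether `p`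
      -- lies in the filter of the inverse image; leastness and monotonicity of `i` settle it.
      ∈filter⇔least-≤ : ∀ φ θ → φ ∈ filter θ ⇔
        (rel (least (var p)) ⇒ rel (inverseImage (const φ) θ))
      ∈filter⇔least-≤ φ θ = mk⇔
        (λ φ∈ {s} {t} → least-≤ (var p) (inverseImage (const φ) θ) (from φ∈) {s} {t})
        (λ ≤θ → to (filter-mono {least (var p)} {inverseImage (const φ) θ}
          (λ {s} {t} → ≤θ {s} {t})
          (∈filter-least (var p))))
        where open Equivalence (∈filter-inverseImage (const φ) θ (var p)) using (to; from)

      -- The previous equivalence at `var p` and `least (var p)` makes this congruence closed under
      -- sending every variable to `p`.
      x₀-defining : ∀ {s t} → rel (least (var p)) s t → (s [ x₀ ] , t [ x₀ ]) ∈ defining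
      x₀-defining {s} {t} st = ≡.subst₂ (rel (least (var p)))
        (≡.sym (x₀-⟨⟩ (var p) s)) (≡.sym (x₀-⟨⟩ (var p) t))
        (Equivalence.to (∈filter⇔least-≤ (var p) (least (var p)))
          (∈filter-least (var p)) st)

    ∈filter⇔defining : ∀ φ θ → φ ∈ filter θ ⇔
      (∀ {δ ε} → (δ , ε) ∈ defining → rel θ (δ ⟨ φ ⟩) (ε ⟨ φ ⟩))
    ∈filter⇔defining φ θ = mk⇔
      (λ φ∈ {δ} {ε} δε → ≡.subst₂ (rel θ) (⟨⟩-const φ δ) (⟨⟩-const φ ε) (to φ∈ δε))
      -- Merging all variables by `x₀` makes the pair a defining equation; its instance at `φ` is
      -- the image of the pair under `const φ`.
      (λ τφ⊆θ → from λ {s} {t} st →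
        ≡.subst₂ (rel θ) (x₀-⟨⟩ φ s) (x₀-⟨⟩ φ t)
          (τφ⊆θ {s [ x₀ ]} {t [ x₀ ]} (x₀-defining {s} {t} st)))
      where open Equivalence (∈filter⇔least-≤ φ θ) using (to; from)

  module _ (τ : Pred (Equation Σ (Fin 1)) ℓ)
           (∈filter⇔τ : ∀ φ (θ : Con) → φ ∈ filter θ ⇔
             (∀ {δ ε} → (δ , ε) ∈ τ → rel θ (δ ⟨ φ ⟩) (ε ⟨ φ ⟩))) where

    ⊆filter⇔τ : (Γ : Pred (Fm Σ X) ℓ) (θ : Con) → Γ ⊆ filter θ ⇔
      (∀ {s t} → (s , t) ∈ τ[ τ ] Γ → rel θ s t)
    ⊆filter⇔τ Γ θ = mk⇔
      (λ { Γ⊆ (γ , δ , ε , γ∈ , δε , refl) →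
           Equivalence.to (∈filter⇔τ γ θ) (Γ⊆ γ∈) δε })
      (λ τΓ⊆θ {γ} γ∈ → Equivalence.from (∈filter⇔τ γ θ)
        λ {δ} {ε} δε → τΓ⊆θ (γ , δ , ε , γ∈ , δε , refl))

    -- Finite generation from injectivity.

    module _ (injective : Injective (Poset._≈_ (CoPoset K F)) (Poset._≈_ (𝒫 F))
                            (PosetHomomorphism.⟦_⟧ (i F))) where

      private
        module Finite (κ : Con) where
          Index : Set ℓ
          Index = ∃[ L ] All (_∈ filter κ) L

          piece : Index → Con
          piece (L , _) = generated K F (τ[ τ ] (_∈ˡ L))

          piece-⊆ : ∀ {L M} (L⊆ : All (_∈ filter κ) L) (M⊆ : All (_∈ filter κ) M) →
            (∀ {γ} → γ ∈ˡ L → γ ∈ˡ M) → rel (piece (L , L⊆)) ⇒ rel (piece (M , M⊆))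
          piece-⊆ L⊆ M⊆ L⊆M = generated-least K F (piece (_ , M⊆))
            λ { (γ , δ , ε , γ∈ , rest) → base (γ , δ , ε , L⊆M γ∈ , rest) }

          piece-directed : IsDirected (CoPoset K F) piece
          piece-directed = (List.[] , []) , λ (L , L⊆) (M , M⊆) →
            (L ++ M , ++⁺ L⊆ M⊆) ,
            piece-⊆ L⊆ (++⁺ L⊆ M⊆) (xs⊆xs++ys L M) ,
            piece-⊆ M⊆ (++⁺ L⊆ M⊆) (xs⊆ys++xs M L)

          union : Con
          union = directedUnion K F piece piece-directed

          piece-≤ : ∀ j → rel (piece j) ⇒ rel κ
          piece-≤ (L , L⊆) = generated-least K F κ
            (Equivalence.to (⊆filter⇔τ (_∈ˡ L) κ) (All.lookup L⊆))

          -- For each `γ` in the filter, the piece of the one-element list already contains τ(γ).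
          filter-⊆-union : filter κ ⊆ filter union
          filter-⊆-union = Equivalence.from (⊆filter⇔τ (filter κ) union)
            λ { (γ , δ , ε , γ∈ , rest) →
                (γ List.∷ List.[] , γ∈ ∷ []) , base (γ , δ , ε , here refl , rest) }

          ≤-union : rel κ ⇒ rel union
          -- Every piece lies below `κ`, so the two filters coincide and injectivity identifies the
          -- congruences.
          ≤-union = proj₂ (injective {union} {κ}
            (filter-mono {union} {κ} (λ (j , p) → piece-≤ j p) , filter-⊆-union))

      -- The pair lies in a single piece, generated by τ(L); if the filter of `θ` contains `L`, then
      -- `θ` contains τ(L) and so that piece.
      finitelyGenerated : ∀ (κ : Con) {s t} → rel κ s t →
        ∃[ L ] All (_∈ filter κ) L ×
          (∀ θ → All (_∈ filter θ) L → rel θ s t)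
      finitelyGenerated κ st =
        let ((L , L⊆) , p) = Finite.≤-union κ st in
        L , L⊆ , λ θ L⊆θ → generated-least K F θ
          (Equivalence.to (⊆filter⇔τ (_∈ˡ L) θ) (All.lookup L⊆θ)) p

    -- The clauses of algebraizability.

    module _ (Δ : List (Fm Σ (Fin 2)))
             (rel⇔Δ : ∀ φ ψ (θ : Con) → rel θ φ ψ ⇔
               (∀ {d} → d ∈ˡ Δ → d ⟪ φ , ψ ⟫ ∈ filter θ)) where

      Δ⊆filter⇔ : (E : Pred (Equation Σ X) ℓ) (θ : Con) →
        Δ[ Δ ] E ⊆ filter θ ⇔
        (∀ {ξ η} → (ξ , η) ∈ E → rel θ ξ η)
      Δ⊆filter⇔ E θ = mk⇔
        (λ ΔE⊆ {ξ} {η} ξη → Equivalence.from (rel⇔Δ ξ η θ)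
          λ {d} d∈ → ΔE⊆ (ξ , η , d , ξη , d∈ , refl))
        (λ { E⊆θ (ξ , η , d , ξη , d∈ , refl) →
             Equivalence.to (rel⇔Δ ξ η θ) (E⊆θ ξη) d∈ })

      private
        _⊢_ : Entailment Σ X
        _⊢_ = associatedLogic (Co K) i X

      -- Both consequence relations quantify over the same `θ`, so premises and conclusions are
      -- translated for each fixed `θ`. The last two clauses compose both translations.
      algebraizable : IsAlgebraizable _⊢_
      algebraizable = record
        { K′   = Member
        ; τ    = τ
        ; Δ    = Δ
        ; ⊢⇔⊨  = λ Γ φ → mk⇔
            (λ (Γ⊢φ : Γ ⊢ φ) {δ} {ε} δε → Equivalence.from
              (⊨⇔∈KCongruences K (τ[ τ ] Γ) (δ ⟨ φ ⟩) (ε ⟨ φ ⟩))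
              λ θ τΓ⊆θ → Equivalence.to (∈filter⇔τ φ θ)
                (Γ⊢φ θ (Equivalence.from (⊆filter⇔τ Γ θ) τΓ⊆θ)) δε)
            (λ τΓ⊨ θ Γ⊆ → Equivalence.from (∈filter⇔τ φ θ)
              λ {δ} {ε} δε → Equivalence.to
                (⊨⇔∈KCongruences K (τ[ τ ] Γ) (δ ⟨ φ ⟩) (ε ⟨ φ ⟩))
                (τΓ⊨ δε) θ (Equivalence.to (⊆filter⇔τ Γ θ) Γ⊆))
        ; ⊨⇔⊢  = λ E φ ψ → mk⇔
            (λ E⊨ {d} d∈ θ (ΔE⊆ : Δ[ Δ ] E ⊆ filter θ) →
              Equivalence.to (rel⇔Δ φ ψ θ)
              (Equivalence.to (⊨⇔∈KCongruences K E φ ψ) E⊨ θ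
                (Equivalence.to (Δ⊆filter⇔ E θ) ΔE⊆)) d∈)
            (λ ΔE⊢ → Equivalence.from (⊨⇔∈KCongruences K E φ ψ) λ θ E⊆θ →
              Equivalence.from (rel⇔Δ φ ψ θ) λ {d} d∈ →
                ΔE⊢ d∈ θ (Equivalence.from (Δ⊆filter⇔ E θ) E⊆θ))
        ; ψ⊢Δτψ = λ ψ χ∈ θ ψ⊆ → Equivalence.from (Δ⊆filter⇔ (τ[ τ ] ｛ ψ ｝) θ)
            (Equivalence.to (⊆filter⇔τ ｛ ψ ｝ θ) ψ⊆) χ∈
        ; Δτψ⊢ψ = λ ψ θ Δτψ⊆ → Equivalence.from (⊆filter⇔τ ｛ ψ ｝ θ)
            (Equivalence.to (Δ⊆filter⇔ (τ[ τ ] ｛ ψ ｝) θ) Δτψ⊆) refl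
        }
        where open Quasivariety K using (Member)

  -- Equivalence formulas in two variables.

  module _ (_≟_ : DecidableEquality X) {p q : X} (p≢q : p ≢ q)
           (κ : Con) (κ-least : ∀ (θ : Con) → rel θ (var p) (var q) → rel κ ⇒ rel θ)
           (L : List (Fm Σ X)) (L⊆κ : All (_∈ filter κ) L)
           (L-generates : ∀ (θ : Con) → All (_∈ filter θ) L → rel θ (var p) (var q)) where

    private
      -- Variables other than `p` and `q` go to the first variable by default. This is harmless: the
      -- argument uses only the values at `p` and `q`.
      index : X → Fin 2
      index w with w ≟ q
      ... | yes _ = suc zero
      ... | no  _ = zero

      index-p : index p ≡ zero
      index-p with p ≟ q
      ... | yes p≡q = contradiction p≡q p≢q
      ... | no  _   = refl

      index-q : index q ≡ suc zero
      index-q with q ≟ q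
      ... | yes _   = refl
      ... | no  q≢q = contradiction refl q≢q

      binary : Fm Σ X → Fm Σ (Fin 2)
      binary γ = γ [ var ∘ index ]

    equivalenceFormulas : List (Fm Σ (Fin 2))
    equivalenceFormulas = List.map binary L

    private
      module _ (φ ψ : Fm Σ X) where
        σ : X → Fm Σ X
        σ w = var (index w) ⟪ φ , ψ ⟫

        σ-p : σ p ≡ φ
        σ-p = ≡.cong (λ k → var k ⟪ φ , ψ ⟫) index-p

        σ-q : σ q ≡ ψ
        σ-q = ≡.cong (λ k → var k ⟪ φ , ψ ⟫) index-q

        binary-⟪⟫ : ∀ γ → binary γ ⟪ φ , ψ ⟫ ≡ γ [ σ ]
        binary-⟪⟫ = []-∘ (λ k → var k ⟪ φ , ψ ⟫) (var ∘ index)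

        binary∈⇔ : ∀ θ γ → binary γ ⟪ φ , ψ ⟫ ∈ filter θ ⇔
          γ ∈ filter (inverseImage σ θ)
        binary∈⇔ θ γ = mk⇔
          (from ∘ ≡.subst (_∈ filter θ) (binary-⟪⟫ γ))
          (≡.subst (_∈ filter θ) (≡.sym (binary-⟪⟫ γ)) ∘ to)
          where open Equivalence (∈filter-inverseImage σ θ γ) using (to; from)

    -- With `σ` sending `p` to `φ` and `q` to `ψ`, the left side says that the inverse image of `θ`
    -- contains (p,q). Then it contains `κ`, so its filter contains `L`; conversely `L` in its
    -- filter forces (p,q).
    rel⇔equivalenceFormulas : ∀ φ ψ θ → rel θ φ ψ ⇔
      (∀ {d} → d ∈ˡ equivalenceFormulas → d ⟪ φ , ψ ⟫ ∈ filter θ)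
    rel⇔equivalenceFormulas φ ψ θ = mk⇔
      (λ φψ {d} d∈ → case ∈-map⁻ binary d∈ of λ
        { (γ , γ∈ , refl) → Equivalence.from (binary∈⇔ φ ψ θ γ)
            (filter-mono {κ} {inverseImage (σ φ ψ) θ} (κ-≤ φψ)
              (All.lookup L⊆κ γ∈)) })
      (λ Δφψ⊆ → ≡.subst₂ (rel θ) (σ-p φ ψ) (σ-q φ ψ)
        (L-generates (inverseImage (σ φ ψ) θ)
          (All.tabulate λ {γ} γ∈ →
            Equivalence.to (binary∈⇔ φ ψ θ γ) (Δφψ⊆ (∈-map⁺ binary γ∈)))))
      where
      κ-≤ : rel θ φ ψ → rel κ ⇒ rel (inverseImage (σ φ ψ) θ)
      κ-≤ φψ = κ-least (inverseImage (σ φ ψ) θ)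
        (≡.subst₂ (rel θ) (≡.sym (σ-p φ ψ)) (≡.sym (σ-q φ ψ)) φψ)

proposition3p7 : ∀ {ℓ} (Σ : Signature ℓ) (K : Quasivariety Σ)
    (X : Set ℓ) → DecidableEquality X → (p q : X) → p ≢ q →
    (i : ∀ A → PosetHomomorphism (CoPoset K A) (𝒫 A)) →
    IsFilterPair (Co K) i →
    Injective (Poset._≈_ (CoPoset K (FmStr Σ X))) (Poset._≈_ (𝒫 (FmStr Σ X))) (PosetHomomorphism.⟦_⟧ (i (FmStr Σ X))) →
    IsAlgebraizable (associatedLogic (Co K) i X)
proposition3p7 Σ K X _≟_ p q p≢q i isFilterPair injective =
  algebraizable K i isFilterPair τ ∈filter⇔τ
    (equivalenceFormulas K i isFilterPair _≟_ p≢q κ κ-least L L⊆κ L-generates)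
    (rel⇔equivalenceFormulas K i isFilterPair _≟_ p≢q κ κ-least L L⊆κ L-generates)
  where
  F = FmStr Σ X

  κ : KCongruence K F
  κ = generated K F ｛ var p , var q ｝

  κ-least : ∀ θ → KCongruence.rel θ (var p) (var q) →
    KCongruence.rel κ ⇒ KCongruence.rel θ
  κ-least θ p∼q = generated-least K F θ λ { refl → p∼q }

  τ = defining K i isFilterPair p
  ∈filter⇔τ = ∈filter⇔defining K i isFilterPair p

  -- Here `base refl` is the generating pair (p,q) of `κ`.
  generators = finitelyGenerated K i isFilterPair τ ∈filter⇔τ injective κ (base refl)
  L = proj₁ generators
  L⊆κ = proj₁ (proj₂ generators)
  L-generates = proj₂ (proj₂ generators)
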